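{- Regular path homology is not invariant with respect to homotopy equivalence of digraphs; that is, there exist finite directed graphs $G$ and $H$ that are homotopy equivalent as digraphs but whose regular path homology groups are not isomorphic.
   Context: $R$ is a fixed nonzero commutative unital ring. A directed graph (digraph) $G$ has vertex set $V(G)$ and edge set $E(G)\subseteq V(G)\times V(G)$, with no loops. Regular path homology: let $\Lambda_n(G)$ be the free $R$-module on all $(n+1)$-tuples of vertices, with $\partial=\sum_{i=0}^n(-1)^i(\text{delete the } i\text{ -th entry})$ (and $\partial=0$ for $n=0$). A tuple $(x_0,\dots,x_n)$ is allowed if $(x_i,x_{i+1})\in E(G)$ for all $i$, and strongly regular if its entries are pairwise distinct. Let $\mathcal{A}^\iota_n(G)\subseteq\Lambda_n(G)$ be spanned by the strongly regular allowed tuples, and $\Omega^\iota_n(G)=\{v\in\mathcal{A}^\iota_n(G)\mid \partial v\in\mathcal{A}^\iota_{n-1}(G)\}$ (with $\Omega^\iota_0=\mathcal{A}^\iota_0$). The regular path homology groups are the homology groups of $(\Omega^\iota_*(G),\partial)$. Homotopy of digraphs (in the sense of Grigor'yan–Lin–Muranov–Yau): a digraph map $f\colon G\to H$ is a function $V(G)\to V(H)$ such that for each edge $(x,y)$ of $G$ either $f(x)=f(y)$ or $(f(x),f(y))\in E(H)$. A line digraph $I$ of length $m\ge 0$ has vertices $0,\dots,m$ and, for each $i<m$, exactly one of the edges $(i,i+1)$, $(i+1,i)$, and no other edges. The box product $G\,\square\, I$ has vertex set $V(G)\times V(I)$ and an edge from $(x,i)$ to $(y,j)$ iff either $x=y$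 and $(i,j)\in E(I)$, or $i=j$ and $(x,y)\in E(G)$. Two digraph maps $f,g\colon G\to H$ are homotopic if there are a line digraph $I$ of some length $m$ and a digraph map $F\colon G\,\square\, I\to H$ with $F(x,0)=f(x)$ and $F(x,m)=g(x)$ for all $x$. Digraphs $G,H$ are homotopy equivalent if there are digraph maps $f\colon G\to H$ and $g\colon H\to G$ with $g\circ f$ and $f\circ g$ homotopic to the respective identities. -}

module Defs where

open import Algebra.Bundles using (CommutativeRing; CommutativeMonoid)
open import Algebra.Module.Bundles using (Module)
import Algebra.Module.Structures.Biased as Biased
import Algebra.Module.Morphism.Structures as Morphism
import Algebra.Module.Properties.LeftModule as LeftModuleProperties
import Algebra.Properties.CommutativeMonoid.Sum as MonoidSum
import Algebra.Properties.CommutativeSemigroup as CommutativeSemigroupProperties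
import Algebra.Properties.Ring as RingProperties
import Algebra.Properties.Semiring.Exp as SemiringExp
open import Data.Bool.Base using (Bool; true; false; if_then_else_)
open import Data.Fin.Base using (Fin; zero; suc; toℕ; fromℕ; inject₁)
import Data.Fin.Properties as Fin
open import Data.List.Base using (List; []; _∷_; _++_; map; length)
open import Data.List.Relation.Unary.All using (All; []; _∷_)
import Data.List.Relation.Unary.All.Properties as All
open import Data.Nat.Base using (ℕ; zero; suc; z≤n; s≤s) renaming (_≤_ to _≤ℕ_)
open import Data.Nat.Properties using (m≤n⇒m≤1+n) renaming (≤-refl to ≤ℕ-refl; ≤-trans to ≤ℕ-trans)
open import Data.Product.Base using (Σ-syntax; ∃-syntax; _×_; _,_; proj₂)
open import Data.Product.Properties using (≡-dec)
open import Data.Sum.Base using (_⊎_; inj₁; inj₂)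
open import Data.Vec.Base using (Vec; removeAt)
import Data.Vec.Properties as Vec
open import Data.Vec.Relation.Unary.Linked using (Linked)
open import Data.Vec.Relation.Unary.Unique.Propositional using (Unique)
open import Function.Base using (_∘_; id; flip)
open import Function.Bundles using (_↔_)
open import Level using (_⊔_) renaming (zero to lzero; suc to lsuc)
open import Relation.Binary.Definitions using (Decidable; DecidableEquality)
open import Relation.Binary.PropositionalEquality.Core using (_≡_; _≢_; refl; sym; cong)
import Relation.Binary.Reasoning.Setoid as SetoidReasoning
open import Relation.Nullary using (¬_; yes; no; does; contradiction)
open import Relation.Unary using (Pred)

-- Decidable equality of vertices is what makes the coefficients of a formal
-- linear combination of tuples of vertices available constructively.

record Digraph : Set₁ where
  field
    Vertex  : Set
    _≟_     : DecidableEquality Vertex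
    Edge    : Vertex → Vertex → Set
    no-loop : ∀ {x} → ¬ Edge x x

record Finite (G : Digraph) : Set where
  open Digraph G
  field
    size  : ℕ
    enum  : Vertex ↔ Fin size
    edge? : Decidable Edge

record DigraphMap (G H : Digraph) : Set where
  private
    module G = Digraph G
    module H = Digraph H
  field
    fun      : G.Vertex → H.Vertex
    fun-edge : ∀ {x y} → G.Edge x y → (fun x ≡ fun y) ⊎ H.Edge (fun x) (fun y)

open DigraphMap public

idᴰ : ∀ {G} → DigraphMap G G
idᴰ = record { fun = id ; fun-edge = inj₂ }

infixr 9 _∘ᴰ_

_∘ᴰ_ : ∀ {G H K} → DigraphMap H K → DigraphMap G H → DigraphMap G K
fun      (g ∘ᴰ f) = fun g ∘ fun f
fun-edge (g ∘ᴰ f) e with fun-edge f e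
... | inj₁ eq = inj₁ (cong (fun g) eq)
... | inj₂ e′ = fun-edge g e′

-- The k-th edge of a line digraph is k → k+1 if the k-th entry of the
-- orientation is true, and k+1 → k if it is false.

data LineEdge {m} (orientation : Fin m → Bool) : Fin (suc m) → Fin (suc m) → Set where
  forward  : ∀ k → orientation k ≡ true  → LineEdge orientation (inject₁ k) (suc k)
  backward : ∀ k → orientation k ≡ false → LineEdge orientation (suc k) (inject₁ k)

inject₁≢suc : ∀ {m} (k : Fin m) → inject₁ k ≢ suc k
inject₁≢suc (suc k) eq = inject₁≢suc k (Fin.suc-injective eq)

line : ∀ {m} → (Fin m → Bool) → Digraph
line {m} orientation = record
  { Vertex  = Fin (suc m)
  ; _≟_     = Fin._≟_
  ; Edge    = LineEdge orientation
  ; no-loop = λ e → irrefl e refl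
  }
  where
  irrefl : ∀ {i j} → LineEdge orientation i j → i ≢ j
  irrefl (forward  k _) eq = inject₁≢suc k eq
  irrefl (backward k _) eq = inject₁≢suc k (sym eq)

infixr 8 _□_

_□_ : Digraph → Digraph → Digraph
G □ I = record
  { Vertex  = G.Vertex × I.Vertex
  ; _≟_     = ≡-dec G._≟_ I._≟_
  ; Edge    = λ (x , i) (y , j) → (x ≡ y × I.Edge i j) ⊎ (i ≡ j × G.Edge x y)
  ; no-loop = λ { (inj₁ (_ , e)) → I.no-loop e ; (inj₂ (_ , e)) → G.no-loop e }
  }
  where
  module G = Digraph G
  module I = Digraph I

Homotopic : ∀ {G H} → DigraphMap G H → DigraphMap G H → Set
Homotopic {G} {H} f g =
  Σ[ m ∈ ℕ ] Σ[ orientation ∈ (Fin m → Bool) ]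
  Σ[ F ∈ DigraphMap (G □ line orientation) H ]
    (∀ x → fun F (x , zero) ≡ fun f x) × (∀ x → fun F (x , fromℕ m) ≡ fun g x)

HomotopyEquivalent : Digraph → Digraph → Set
HomotopyEquivalent G H =
  Σ[ f ∈ DigraphMap G H ] Σ[ g ∈ DigraphMap H G ]
    Homotopic (g ∘ᴰ f) idᴰ × Homotopic (f ∘ᴰ g) idᴰ

module _ {c ℓ} {R : CommutativeRing c ℓ} where

  open CommutativeRing R using (Carrier)

  record LinearMap {a ℓa b ℓb} (M : Module R a ℓa) (N : Module R b ℓb)
                   : Set (c ⊔ a ⊔ ℓa ⊔ b ⊔ ℓb) where
    private
      module M = Module M
      module N = Module N
    field
      to                       : M.Carrierᴹ → N.Carrierᴹ
      isLeftModuleHomomorphism : Morphism.IsLeftModuleHomomorphism M.rawLeftModule N.rawLeftModule to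

    open Morphism.IsLeftModuleHomomorphism isLeftModuleHomomorphism public

  infix 4 _≅_

  _≅_ : ∀ {a ℓa b ℓb} → Module R a ℓa → Module R b ℓb → Set _
  M ≅ N = ∃[ f ] Morphism.IsModuleIsomorphism (Module.rawModule M) (Module.rawModule N) f

  record Submodule {a ℓa} (M : Module R a ℓa) p : Set (c ⊔ a ⊔ ℓa ⊔ lsuc p) where
    open Module M
    field
      Member   : Pred Carrierᴹ p
      resp     : ∀ {x y} → x ≈ᴹ y → Member x → Member y
      0-mem    : Member 0ᴹ
      +-mem    : ∀ {x y} → Member x → Member y → Member (x +ᴹ y)
      *ₗ-mem   : ∀ r {x} → Member x → Member (r *ₗ x)

  module _ {a ℓa} (M : Module R a ℓa) where

    open Module M
    open CommutativeRing R using (1#; -_; -‿inverseˡ)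
    open SetoidReasoning ≈ᴹ-setoid

    -1*ₗ : ∀ x → (- 1#) *ₗ x ≈ᴹ -ᴹ x
    -1*ₗ x = LeftModuleProperties.inverseˡ-uniqueᴹ leftModule _ _ (begin
      (- 1#) *ₗ x +ᴹ x        ≈⟨ +ᴹ-congˡ (*ₗ-identityˡ x) ⟨
      (- 1#) *ₗ x +ᴹ 1# *ₗ x  ≈⟨ *ₗ-distribʳ x (- 1#) 1# ⟨
      _ *ₗ x                  ≈⟨ *ₗ-congʳ (-‿inverseˡ 1#) ⟩
      _ *ₗ x                  ≈⟨ *ₗ-zeroˡ x ⟩
      0ᴹ                      ∎)

  module _ {a ℓa b ℓb} {M : Module R a ℓa} {N : Module R b ℓb} where

    private
      module M = Module M
      module N = Module N

    linearMap : (f : M.Carrierᴹ → N.Carrierᴹ) →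
                (∀ {x y} → x M.≈ᴹ y → f x N.≈ᴹ f y) →
                (∀ x y → f (x M.+ᴹ y) N.≈ᴹ f x N.+ᴹ f y) →
                (∀ r x → f (r M.*ₗ x) N.≈ᴹ r N.*ₗ f x) →
                LinearMap M N
    linearMap f f-cong f-+ f-*ₗ = record
      { to = f
      ; isLeftModuleHomomorphism = record
        { +ᴹ-isGroupHomomorphism = record
          { isMonoidHomomorphism = record
            { isMagmaHomomorphism = record
              { isRelHomomorphism = record { cong = f-cong }
              ; homo              = f-+
              }
            ; ε-homo = begin
                f M.0ᴹ               ≈⟨ f-cong (M.*ₗ-zeroˡ M.0ᴹ) ⟨
                f (0# M.*ₗ M.0ᴹ)     ≈⟨ f-*ₗ 0# M.0ᴹ ⟩
                0# N.*ₗ f M.0ᴹ       ≈⟨ N.*ₗ-zeroˡ _ ⟩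
                N.0ᴹ                 ∎
            }
          ; ⁻¹-homo = λ x → begin
              f (M.-ᴹ x)             ≈⟨ f-cong (-1*ₗ M x) ⟨
              f ((- 1#) M.*ₗ x)      ≈⟨ f-*ₗ (- 1#) x ⟩
              (- 1#) N.*ₗ f x        ≈⟨ -1*ₗ N (f x) ⟩
              N.-ᴹ f x               ∎
          }
        ; *ₗ-homo = f-*ₗ
        }
      }
      where
      open CommutativeRing R using (0#; 1#; -_)
      open SetoidReasoning N.≈ᴹ-setoid

    module _ (f : LinearMap M N) where

      private module f = LinearMap f

      preimage : ∀ {p} → Submodule N p → Submodule M p
      preimage P = record
        { Member = P.Member ∘ f.to
        ; resp   = P.resp ∘ f.⟦⟧-cong
        ; 0-mem  = P.resp (N.≈ᴹ-sym f.0ᴹ-homo) P.0-mem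
        ; +-mem  = λ p q → P.resp (N.≈ᴹ-sym (f.+ᴹ-homo _ _)) (P.+-mem p q)
        ; *ₗ-mem = λ r p → P.resp (N.≈ᴹ-sym (f.*ₗ-homo _ _)) (P.*ₗ-mem r p)
        }
        where module P = Submodule P

      image : ∀ {p} → Submodule M p → Submodule N (a ⊔ p ⊔ ℓb)
      image P = record
        { Member = λ y → ∃[ x ] P.Member x × f.to x N.≈ᴹ y
        ; resp   = λ { y≈z (x , p , eq) → x , p , N.≈ᴹ-trans eq y≈z }
        ; 0-mem  = M.0ᴹ , P.0-mem , f.0ᴹ-homo
        ; +-mem  = λ { (x , p , eq) (y , q , eq′) →
                     x M.+ᴹ y , P.+-mem p q
                   , N.≈ᴹ-trans (f.+ᴹ-homo x y) (N.+ᴹ-cong eq eq′) }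
        ; *ₗ-mem = λ { r (x , p , eq) →
                     r M.*ₗ x , P.*ₗ-mem r p
                   , N.≈ᴹ-trans (f.*ₗ-homo r x) (N.*ₗ-congˡ eq) }
        }
        where module P = Submodule P

  module _ {a ℓa} {M : Module R a ℓa} where

    open Module M

    zeroSubmodule : Submodule M ℓa
    zeroSubmodule = record
      { Member = _≈ᴹ 0ᴹ
      ; resp   = λ x≈y x≈0 → ≈ᴹ-trans (≈ᴹ-sym x≈y) x≈0
      ; 0-mem  = ≈ᴹ-refl
      ; +-mem  = λ p q → ≈ᴹ-trans (+ᴹ-cong p q) (+ᴹ-identityˡ 0ᴹ)
      ; *ₗ-mem = λ r p → ≈ᴹ-trans (*ₗ-congˡ p) (*ₗ-zeroʳ r)
      }

    infixr 7 _∩_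

    _∩_ : ∀ {p q} → Submodule M p → Submodule M q → Submodule M (p ⊔ q)
    P ∩ Q = record
      { Member = λ x → P.Member x × Q.Member x
      ; resp   = λ { eq (p , q) → P.resp eq p , Q.resp eq q }
      ; 0-mem  = P.0-mem , Q.0-mem
      ; +-mem  = λ { (p , q) (p′ , q′) → P.+-mem p p′ , Q.+-mem q q′ }
      ; *ₗ-mem = λ { r (p , q) → P.*ₗ-mem r p , Q.*ₗ-mem r q }
      }
      where
      module P = Submodule P
      module Q = Submodule Q

    -- P / Q is the module of elements of P, two of them being identified when
    -- their difference lies in Q; it is the quotient in the usual sense when
    -- Q is contained in P, and P / (P ∩ Q) in general.

    infix 6 _/_

    _/_ : ∀ {p q} → Submodule M p → Submodule M q → Module R (a ⊔ p) q
    P / Q = record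
      { Carrierᴹ = Σ[ x ∈ Carrierᴹ ] P.Member x
      ; _≈ᴹ_     = λ (x , _) (y , _) → x ∼ y
      ; _+ᴹ_     = λ (x , p) (y , q) → x +ᴹ y , P.+-mem p q
      ; _*ₗ_     = λ r (x , p) → r *ₗ x , P.*ₗ-mem r p
      ; _*ᵣ_     = λ (x , p) r → r *ₗ x , P.*ₗ-mem r p
      ; 0ᴹ       = 0ᴹ , P.0-mem
      ; -ᴹ_      = λ (x , p) → -ᴹ x , neg-mem P p
      ; isModule = Biased.IsModuleFromLeft.isModule {commutativeRing = R} (record
        { isLeftModule = record
          { isLeftSemimodule = record
            { +ᴹ-isCommutativeMonoid = record
              { isMonoid = record
                { isSemigroup = record
                  { isMagma = record
                    { isEquivalence = record
                      { refl  = ≈⇒∼ ≈ᴹ-refl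
                      ; sym   = ∼-sym
                      ; trans = ∼-trans
                      }
                    ; ∙-cong = ∼-+
                    }
                  ; assoc = λ _ _ _ → ≈⇒∼ (+ᴹ-assoc _ _ _)
                  }
                ; identity = (λ _ → ≈⇒∼ (+ᴹ-identityˡ _)) , (λ _ → ≈⇒∼ (+ᴹ-identityʳ _))
                }
              ; comm = λ _ _ → ≈⇒∼ (+ᴹ-comm _ _)
              }
            ; isPreleftSemimodule = record
              { *ₗ-cong      = λ {r} {s} {(x , _)} r≈s x∼y →
                               ∼-trans (≈⇒∼ (*ₗ-congʳ r≈s)) (∼-*ₗ s x∼y)
              ; *ₗ-zeroˡ     = λ _ → ≈⇒∼ (*ₗ-zeroˡ _)
              ; *ₗ-distribʳ  = λ _ _ _ → ≈⇒∼ (*ₗ-distribʳ _ _ _)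
              ; *ₗ-identityˡ = λ _ → ≈⇒∼ (*ₗ-identityˡ _)
              ; *ₗ-assoc     = λ _ _ _ → ≈⇒∼ (*ₗ-assoc _ _ _)
              ; *ₗ-zeroʳ     = λ _ → ≈⇒∼ (*ₗ-zeroʳ _)
              ; *ₗ-distribˡ  = λ _ _ _ → ≈⇒∼ (*ₗ-distribˡ _ _ _)
              }
            }
          ; -ᴹ‿cong    = λ x∼y → ∼-trans (≈⇒∼ (≈ᴹ-sym (-1*ₗ M _)))
                                 (∼-trans (∼-*ₗ (- 1#) x∼y) (≈⇒∼ (-1*ₗ M _)))
          ; -ᴹ‿inverse = (λ _ → ≈⇒∼ (-ᴹ‿inverseˡ _)) , (λ _ → ≈⇒∼ (-ᴹ‿inverseʳ _))
          }
        })
      }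
      where
      open CommutativeRing R using (1#; -_)
      open SetoidReasoning ≈ᴹ-setoid
      open CommutativeSemigroupProperties
        (CommutativeMonoid.commutativeSemigroup +ᴹ-commutativeMonoid) using (interchange)
      module P = Submodule P
      module Q = Submodule Q

      infix 4 _∼_
      _∼_ : Carrierᴹ → Carrierᴹ → Set _
      x ∼ y = Q.Member (x +ᴹ -ᴹ y)

      neg-mem : ∀ {s} (S : Submodule M s) {x} → Submodule.Member S x → Submodule.Member S (-ᴹ x)
      neg-mem S m = Submodule.resp S (-1*ₗ M _) (Submodule.*ₗ-mem S (- 1#) m)

      ≈⇒∼ : ∀ {x y} → x ≈ᴹ y → x ∼ y
      ≈⇒∼ {x} {y} x≈y = Q.resp (begin
        0ᴹ         ≈⟨ -ᴹ‿inverseʳ y ⟨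
        y +ᴹ -ᴹ y  ≈⟨ +ᴹ-congʳ x≈y ⟨
        x +ᴹ -ᴹ y  ∎) Q.0-mem

      ∼-trans : ∀ {x y z} → x ∼ y → y ∼ z → x ∼ z
      ∼-trans {x} {y} {z} p q = Q.resp (begin
        (x +ᴹ -ᴹ y) +ᴹ (y +ᴹ -ᴹ z)  ≈⟨ +ᴹ-assoc x (-ᴹ y) _ ⟩
        x +ᴹ (-ᴹ y +ᴹ (y +ᴹ -ᴹ z))  ≈⟨ +ᴹ-congˡ (+ᴹ-assoc (-ᴹ y) y _) ⟨
        x +ᴹ ((-ᴹ y +ᴹ y) +ᴹ -ᴹ z)  ≈⟨ +ᴹ-congˡ (+ᴹ-congʳ (-ᴹ‿inverseˡ y)) ⟩
        x +ᴹ (0ᴹ +ᴹ -ᴹ z)           ≈⟨ +ᴹ-congˡ (+ᴹ-identityˡ _) ⟩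
        x +ᴹ -ᴹ z                   ∎) (Q.+-mem p q)

      ∼-*ₗ : ∀ r {x y} → x ∼ y → r *ₗ x ∼ r *ₗ y
      ∼-*ₗ r {x} {y} p = Q.resp (begin
        r *ₗ (x +ᴹ -ᴹ y)       ≈⟨ *ₗ-distribˡ r x (-ᴹ y) ⟩
        r *ₗ x +ᴹ r *ₗ (-ᴹ y)  ≈⟨ +ᴹ-congˡ (LeftModuleProperties.inverseˡ-uniqueᴹ leftModule _ _ r[-y]+ry≈0) ⟩
        r *ₗ x +ᴹ -ᴹ (r *ₗ y)  ∎) (Q.*ₗ-mem r p)
        where
        r[-y]+ry≈0 : r *ₗ (-ᴹ y) +ᴹ r *ₗ y ≈ᴹ 0ᴹ
        r[-y]+ry≈0 = begin
          r *ₗ (-ᴹ y) +ᴹ r *ₗ y  ≈⟨ *ₗ-distribˡ r (-ᴹ y) y ⟨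
          r *ₗ (-ᴹ y +ᴹ y)       ≈⟨ *ₗ-congˡ (-ᴹ‿inverseˡ y) ⟩
          r *ₗ 0ᴹ                ≈⟨ *ₗ-zeroʳ r ⟩
          0ᴹ                     ∎

      ∼-+ : ∀ {x x′ y y′} → x ∼ x′ → y ∼ y′ → x +ᴹ y ∼ x′ +ᴹ y′
      ∼-+ {x} {x′} {y} {y′} p q = Q.resp (begin
        (x +ᴹ -ᴹ x′) +ᴹ (y +ᴹ -ᴹ y′)  ≈⟨ interchange x (-ᴹ x′) y (-ᴹ y′) ⟩
        (x +ᴹ y) +ᴹ (-ᴹ x′ +ᴹ -ᴹ y′)  ≈⟨ +ᴹ-congˡ (+ᴹ-cong (-1*ₗ M x′) (-1*ₗ M y′)) ⟨
        (x +ᴹ y) +ᴹ ((- 1#) *ₗ x′ +ᴹ (- 1#) *ₗ y′)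
                                      ≈⟨ +ᴹ-congˡ (*ₗ-distribˡ (- 1#) x′ y′) ⟨
        (x +ᴹ y) +ᴹ (- 1#) *ₗ (x′ +ᴹ y′)  ≈⟨ +ᴹ-congˡ (-1*ₗ M _) ⟩
        (x +ᴹ y) +ᴹ -ᴹ (x′ +ᴹ y′)     ∎) (Q.+-mem p q)

      ∼-sym : ∀ {x y} → x ∼ y → y ∼ x
      ∼-sym {x} {y} p = Q.resp (≈ᴹ-sym (LeftModuleProperties.inverseˡ-uniqueᴹ leftModule _ _ (begin
        (y +ᴹ -ᴹ x) +ᴹ (x +ᴹ -ᴹ y)  ≈⟨ +ᴹ-assoc y (-ᴹ x) _ ⟩
        y +ᴹ (-ᴹ x +ᴹ (x +ᴹ -ᴹ y))  ≈⟨ +ᴹ-congˡ (+ᴹ-assoc (-ᴹ x) x _) ⟨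
        y +ᴹ ((-ᴹ x +ᴹ x) +ᴹ -ᴹ y)  ≈⟨ +ᴹ-congˡ (+ᴹ-congʳ (-ᴹ‿inverseˡ x)) ⟩
        y +ᴹ (0ᴹ +ᴹ -ᴹ y)           ≈⟨ +ᴹ-congˡ (+ᴹ-identityˡ _) ⟩
        y +ᴹ -ᴹ y                   ≈⟨ -ᴹ‿inverseʳ y ⟩
        0ᴹ                          ∎))) (neg-mem Q p)

-- An element of the free module on X is a formal linear combination, written
-- as a list of scaled basis elements; two are equal if all their coefficients
-- agree.

module Free {c ℓ} (R : CommutativeRing c ℓ) {X : Set} (_≟_ : DecidableEquality X) where

  open CommutativeRing R renaming (refl to ≈-refl; sym to ≈-sym; trans to ≈-trans)

  Combination : Set c
  Combination = List (Carrier × X)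

  coeff : Combination → X → Carrier
  coeff []            x = 0#
  coeff ((r , y) ∷ v) x = (if does (y ≟ x) then r else 0#) + coeff v x

  scale : Carrier → Combination → Combination
  scale r = map λ (s , x) → r * s , x

  basis : X → Combination
  basis x = (1# , x) ∷ []

  coeff-++ : ∀ v w x → coeff (v ++ w) x ≈ coeff v x + coeff w x
  coeff-++ []            w x = ≈-sym (+-identityˡ _)
  coeff-++ ((r , y) ∷ v) w x = ≈-trans (+-congˡ (coeff-++ v w x)) (≈-sym (+-assoc _ _ _))

  coeff-scale : ∀ r v x → coeff (scale r v) x ≈ r * coeff v x
  coeff-scale r []            x = ≈-sym (zeroʳ r)
  coeff-scale r ((s , y) ∷ v) x with does (y ≟ x)
  ... | true  = ≈-trans (+-congˡ (coeff-scale r v x)) (≈-sym (distribˡ r _ _))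
  ... | false = ≈-trans (+-cong (≈-sym (zeroʳ r)) (coeff-scale r v x)) (≈-sym (distribˡ r _ _))

  private
    infix 4 _≈ᶜ_
    _≈ᶜ_ : Combination → Combination → Set ℓ
    v ≈ᶜ w = ∀ x → coeff v x ≈ coeff w x

    module ≈-Reasoning = SetoidReasoning setoid

    neg-coeff : ∀ v x → coeff (scale (- 1#) v) x ≈ - coeff v x
    neg-coeff v x = ≈-trans (coeff-scale (- 1#) v x) (RingProperties.-1*x≈-x ring _)

    ++-cong : ∀ {v v′ w w′} → v ≈ᶜ v′ → w ≈ᶜ w′ → v ++ w ≈ᶜ v′ ++ w′
    ++-cong {v} {v′} {w} {w′} p q x = begin
      coeff (v ++ w) x          ≈⟨ coeff-++ v w x ⟩
      coeff v x + coeff w x     ≈⟨ +-cong (p x) (q x) ⟩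
      coeff v′ x + coeff w′ x   ≈⟨ coeff-++ v′ w′ x ⟨
      coeff (v′ ++ w′) x        ∎
      where open ≈-Reasoning

    ++-assoc : ∀ u v w → (u ++ v) ++ w ≈ᶜ u ++ (v ++ w)
    ++-assoc u v w x = begin
      coeff ((u ++ v) ++ w) x                ≈⟨ coeff-++ (u ++ v) w x ⟩
      coeff (u ++ v) x + coeff w x           ≈⟨ +-congʳ (coeff-++ u v x) ⟩
      (coeff u x + coeff v x) + coeff w x    ≈⟨ +-assoc _ _ _ ⟩
      coeff u x + (coeff v x + coeff w x)    ≈⟨ +-congˡ (coeff-++ v w x) ⟨
      coeff u x + coeff (v ++ w) x           ≈⟨ coeff-++ u (v ++ w) x ⟨
      coeff (u ++ (v ++ w)) x                ∎
      where open ≈-Reasoning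

    ++-comm : ∀ v w → v ++ w ≈ᶜ w ++ v
    ++-comm v w x = begin
      coeff (v ++ w) x        ≈⟨ coeff-++ v w x ⟩
      coeff v x + coeff w x   ≈⟨ +-comm _ _ ⟩
      coeff w x + coeff v x   ≈⟨ coeff-++ w v x ⟨
      coeff (w ++ v) x        ∎
      where open ≈-Reasoning

    scale-cong : ∀ {r s v w} → r ≈ s → v ≈ᶜ w → scale r v ≈ᶜ scale s w
    scale-cong {r} {s} {v} {w} r≈s p x = begin
      coeff (scale r v) x  ≈⟨ coeff-scale r v x ⟩
      r * coeff v x        ≈⟨ *-cong r≈s (p x) ⟩
      s * coeff w x        ≈⟨ coeff-scale s w x ⟨
      coeff (scale s w) x  ∎
      where open ≈-Reasoning

    scale-distribʳ : ∀ v r s → scale (r + s) v ≈ᶜ scale r v ++ scale s v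
    scale-distribʳ v r s x = begin
      coeff (scale (r + s) v) x                      ≈⟨ coeff-scale (r + s) v x ⟩
      (r + s) * coeff v x                            ≈⟨ distribʳ _ r s ⟩
      r * coeff v x + s * coeff v x                  ≈⟨ +-cong (coeff-scale r v x) (coeff-scale s v x) ⟨
      coeff (scale r v) x + coeff (scale s v) x      ≈⟨ coeff-++ (scale r v) (scale s v) x ⟨
      coeff (scale r v ++ scale s v) x               ∎
      where open ≈-Reasoning

    scale-assoc : ∀ r s v → scale (r * s) v ≈ᶜ scale r (scale s v)
    scale-assoc r s v x = begin
      coeff (scale (r * s) v) x        ≈⟨ coeff-scale (r * s) v x ⟩
      r * s * coeff v x                ≈⟨ *-assoc r s _ ⟩
      r * (s * coeff v x)              ≈⟨ *-congˡ (coeff-scale s v x) ⟨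
      r * coeff (scale s v) x          ≈⟨ coeff-scale r (scale s v) x ⟨
      coeff (scale r (scale s v)) x    ∎
      where open ≈-Reasoning

    scale-distribˡ : ∀ r v w → scale r (v ++ w) ≈ᶜ scale r v ++ scale r w
    scale-distribˡ r v w x = begin
      coeff (scale r (v ++ w)) x                   ≈⟨ coeff-scale r (v ++ w) x ⟩
      r * coeff (v ++ w) x                         ≈⟨ *-congˡ (coeff-++ v w x) ⟩
      r * (coeff v x + coeff w x)                  ≈⟨ distribˡ r _ _ ⟩
      r * coeff v x + r * coeff w x                ≈⟨ +-cong (coeff-scale r v x) (coeff-scale r w x) ⟨
      coeff (scale r v) x + coeff (scale r w) x    ≈⟨ coeff-++ (scale r v) (scale r w) x ⟨
      coeff (scale r v ++ scale r w) x             ∎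
      where open ≈-Reasoning

    ++-inverseˡ : ∀ v → scale (- 1#) v ++ v ≈ᶜ []
    ++-inverseˡ v x = begin
      coeff (scale (- 1#) v ++ v) x            ≈⟨ coeff-++ (scale (- 1#) v) v x ⟩
      coeff (scale (- 1#) v) x + coeff v x     ≈⟨ +-congʳ (neg-coeff v x) ⟩
      - coeff v x + coeff v x                  ≈⟨ -‿inverseˡ _ ⟩
      0#                                       ∎
      where open ≈-Reasoning

  free : Module R c ℓ
  free = record
    { Carrierᴹ = Combination
    ; _≈ᴹ_     = _≈ᶜ_
    ; _+ᴹ_     = _++_
    ; _*ₗ_     = scale
    ; _*ᵣ_     = flip scale
    ; 0ᴹ       = []
    ; -ᴹ_      = scale (- 1#)
    ; isModule = Biased.IsModuleFromLeft.isModule {commutativeRing = R} (record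
      { isLeftModule = record
        { isLeftSemimodule = record
          { +ᴹ-isCommutativeMonoid = record
            { isMonoid = record
              { isSemigroup = record
                { isMagma = record
                  { isEquivalence = record
                    { refl  = λ _ → ≈-refl
                    ; sym   = λ p x → ≈-sym (p x)
                    ; trans = λ p q x → ≈-trans (p x) (q x)
                    }
                  ; ∙-cong = λ {v} {v′} {w} {w′} → ++-cong {v} {v′} {w} {w′}
                  }
                ; assoc = ++-assoc
                }
              ; identity = (λ _ _ → ≈-refl)
                         , (λ v x → ≈-trans (coeff-++ v [] x) (+-identityʳ _))
              }
            ; comm = ++-comm
            }
          ; isPreleftSemimodule = record
            { *ₗ-cong      = λ {r} {s} {v} {w} → scale-cong {r} {s} {v} {w}
            ; *ₗ-zeroˡ     = λ v x → ≈-trans (coeff-scale 0# v x) (zeroˡ _)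
            ; *ₗ-distribʳ  = scale-distribʳ
            ; *ₗ-identityˡ = λ v x → ≈-trans (coeff-scale 1# v x) (*-identityˡ _)
            ; *ₗ-assoc     = scale-assoc
            ; *ₗ-zeroʳ     = λ _ _ → ≈-refl
            ; *ₗ-distribˡ  = scale-distribˡ
            }
          }
        ; -ᴹ‿cong    = λ {v} {w} → scale-cong { - 1# } { - 1# } {v} {w} ≈-refl
        ; -ᴹ‿inverse = ++-inverseˡ
                     , (λ v x → ≈-trans (++-comm v (scale (- 1#) v) x) (++-inverseˡ v x))
        }
      })
    }

  span : Pred X lzero → Submodule free (c ⊔ ℓ)
  span S = record
    { Member = λ v → ∃[ w ] All (S ∘ proj₂) w × w ≈ᶜ v
    ; resp   = λ { v≈v′ (w , s , w≈v) → w , s , λ x → ≈-trans (w≈v x) (v≈v′ x) }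
    ; 0-mem  = [] , [] , λ _ → ≈-refl
    ; +-mem  = λ { {v} {v′} (w , s , p) (w′ , s′ , p′) →
                 w ++ w′ , All.++⁺ s s′ , ++-cong {w} {v} {w′} {v′} p p′ }
    ; *ₗ-mem = λ { r {v} (w , s , p) →
                 scale r w , All.map⁺ s , scale-cong {r} {r} {w} {v} ≈-refl p }
    }

  module _ {a ℓa} (M : Module R a ℓa) (f : X → Module.Carrierᴹ M) where

    open Module M

    extend : Combination → Carrierᴹ
    extend []            = 0ᴹ
    extend ((r , x) ∷ v) = r *ₗ f x +ᴹ extend v

    private
      module ≈ᴹ-Reasoning = SetoidReasoning ≈ᴹ-setoid
      open CommutativeSemigroupProperties
        (CommutativeMonoid.commutativeSemigroup +ᴹ-commutativeMonoid) using (x∙yz≈y∙xz)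

      extend-++ : ∀ v w → extend (v ++ w) ≈ᴹ extend v +ᴹ extend w
      extend-++ []            w = ≈ᴹ-sym (+ᴹ-identityˡ _)
      extend-++ ((r , x) ∷ v) w = ≈ᴹ-trans (+ᴹ-congˡ (extend-++ v w)) (≈ᴹ-sym (+ᴹ-assoc _ _ _))

      extend-scale : ∀ r v → extend (scale r v) ≈ᴹ r *ₗ extend v
      extend-scale r []            = ≈ᴹ-sym (*ₗ-zeroʳ r)
      extend-scale r ((s , x) ∷ v) =
        ≈ᴹ-trans (+ᴹ-cong (*ₗ-assoc r s (f x)) (extend-scale r v)) (≈ᴹ-sym (*ₗ-distribˡ r _ _))

      delete : X → Combination → Combination
      delete x []            = []
      delete x ((r , y) ∷ v) = if does (y ≟ x) then delete x v else (r , y) ∷ delete x v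

      length-delete : ∀ x v → length (delete x v) ≤ℕ length v
      length-delete x []            = z≤n
      length-delete x ((r , y) ∷ v) with does (y ≟ x)
      ... | true  = m≤n⇒m≤1+n (length-delete x v)
      ... | false = s≤s (length-delete x v)

      coeff-delete-≡ : ∀ x v → coeff (delete x v) x ≈ 0#
      coeff-delete-≡ x []            = ≈-refl
      coeff-delete-≡ x ((r , y) ∷ v) with does (y ≟ x) in eq
      ... | true  = coeff-delete-≡ x v
      ... | false rewrite eq = ≈-trans (+-identityˡ _) (coeff-delete-≡ x v)

      coeff-delete-≢ : ∀ x v y → x ≢ y → coeff (delete x v) y ≈ coeff v y
      coeff-delete-≢ x []            y x≢y = ≈-refl
      coeff-delete-≢ x ((r , z) ∷ v) y x≢y with z ≟ x
      ... | no  _    = +-congˡ (coeff-delete-≢ x v y x≢y)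
      ... | yes refl with z ≟ y
      ...   | yes z≡y = contradiction z≡y x≢y
      ...   | no  _   = ≈-trans (coeff-delete-≢ x v y x≢y) (≈-sym (+-identityˡ _))

      extend-delete : ∀ x v → extend v ≈ᴹ coeff v x *ₗ f x +ᴹ extend (delete x v)
      extend-delete x []            = ≈ᴹ-sym (≈ᴹ-trans (+ᴹ-identityʳ _) (*ₗ-zeroˡ _))
      extend-delete x ((r , y) ∷ v) with y ≟ x
      ... | yes refl = begin
        r *ₗ f y +ᴹ extend v                                          ≈⟨ +ᴹ-congˡ (extend-delete y v) ⟩
        r *ₗ f y +ᴹ (coeff v y *ₗ f y +ᴹ extend (delete y v))         ≈⟨ +ᴹ-assoc _ _ _ ⟨
        (r *ₗ f y +ᴹ coeff v y *ₗ f y) +ᴹ extend (delete y v)         ≈⟨ +ᴹ-congʳ (*ₗ-distribʳ (f y) r _) ⟨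
        (r + coeff v y) *ₗ f y +ᴹ extend (delete y v)                 ∎
        where open ≈ᴹ-Reasoning
      ... | no _ = begin
        r *ₗ f y +ᴹ extend v                                          ≈⟨ +ᴹ-congˡ (extend-delete x v) ⟩
        r *ₗ f y +ᴹ (coeff v x *ₗ f x +ᴹ extend (delete x v))         ≈⟨ x∙yz≈y∙xz _ _ _ ⟩
        coeff v x *ₗ f x +ᴹ (r *ₗ f y +ᴹ extend (delete x v))         ≈⟨ +ᴹ-congʳ (*ₗ-congʳ (+-identityˡ _)) ⟨
        (0# + coeff v x) *ₗ f x +ᴹ (r *ₗ f y +ᴹ extend (delete x v))  ∎
        where open ≈ᴹ-Reasoning

      extend-zero : ∀ n v → length v ≤ℕ n → v ≈ᶜ [] → extend v ≈ᴹ 0ᴹ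
      extend-zero n       []              _         _ = ≈ᴹ-refl
      extend-zero (suc n) v@((r , x) ∷ w) (s≤s w≤n) p = begin
        extend v                                 ≈⟨ extend-delete x v ⟩
        coeff v x *ₗ f x +ᴹ extend (delete x v)  ≈⟨ +ᴹ-cong (*ₗ-congʳ (p x)) (extend-zero n (delete x v) shorter zero-coeffs) ⟩
        0# *ₗ f x +ᴹ 0ᴹ                          ≈⟨ +ᴹ-identityʳ _ ⟩
        0# *ₗ f x                                ≈⟨ *ₗ-zeroˡ _ ⟩
        0ᴹ                                       ∎
        where
        open ≈ᴹ-Reasoning

        shorter : length (delete x v) ≤ℕ n
        shorter with x ≟ x
        ... | yes _   = ≤ℕ-trans (length-delete x w) w≤n
        ... | no  x≢x = contradiction refl x≢x

        zero-coeffs : delete x v ≈ᶜ []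
        zero-coeffs y with x ≟ y
        ... | yes refl = coeff-delete-≡ x v
        ... | no  x≢y  = ≈-trans (coeff-delete-≢ x v y x≢y) (p y)

      extend-cong : ∀ {v w} → v ≈ᶜ w → extend v ≈ᴹ extend w
      extend-cong {v} {w} p = begin
        extend v                                        ≈⟨ +ᴹ-identityʳ _ ⟨
        extend v +ᴹ 0ᴹ                                  ≈⟨ +ᴹ-congˡ (-ᴹ‿inverseˡ _) ⟨
        extend v +ᴹ (-ᴹ extend w +ᴹ extend w)           ≈⟨ +ᴹ-assoc _ _ _ ⟨
        (extend v +ᴹ -ᴹ extend w) +ᴹ extend w           ≈⟨ +ᴹ-congʳ (+ᴹ-congˡ (-1*ₗ M _)) ⟨
        (extend v +ᴹ (- 1#) *ₗ extend w) +ᴹ extend w    ≈⟨ +ᴹ-congʳ (+ᴹ-congˡ (extend-scale (- 1#) w)) ⟨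
        (extend v +ᴹ extend (scale (- 1#) w)) +ᴹ extend w
                                                        ≈⟨ +ᴹ-congʳ (extend-++ v (scale (- 1#) w)) ⟨
        extend (v ++ scale (- 1#) w) +ᴹ extend w        ≈⟨ +ᴹ-congʳ (extend-zero _ (v ++ scale (- 1#) w) ≤ℕ-refl v-w≈0) ⟩
        0ᴹ +ᴹ extend w                                  ≈⟨ +ᴹ-identityˡ _ ⟩
        extend w                                        ∎
        where
        open ≈ᴹ-Reasoning

        v-w≈0 : v ++ scale (- 1#) w ≈ᶜ []
        v-w≈0 x = ≈-trans (coeff-++ v (scale (- 1#) w) x)
                 (≈-trans (+-cong (p x) (neg-coeff w x)) (-‿inverseʳ _))

    linearExtension : LinearMap free M
    linearExtension = linearMap extend (λ {v} {w} → extend-cong {v} {w}) extend-++ extend-scale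

module RegularPaths {c ℓ} (R : CommutativeRing c ℓ) (G : Digraph) where

  open CommutativeRing R using (1#; -_; semiring)
  open SemiringExp semiring using (_^_)
  open Digraph G

  Tuple : ℕ → Set
  Tuple n = Vec Vertex (suc n)

  module Λ n = Free R {Tuple n} (Vec.≡-dec _≟_)

  Λ : ℕ → Module R c ℓ
  Λ n = Λ.free n

  ∂ : ∀ n → LinearMap (Λ (suc n)) (Λ n)
  ∂ n = Λ.linearExtension (suc n) (Λ n) λ t →
    ∑[ i ≤ suc n ] ((- 1#) ^ toℕ i *ₗ Λ.basis n (removeAt t i))
    where
    open Module (Λ n) using (_*ₗ_; +ᴹ-commutativeMonoid)
    open MonoidSum +ᴹ-commutativeMonoid using (sum⁺-syntax)

  Allowed : ∀ {n} → Tuple n → Set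
  Allowed = Linked Edge

  StronglyRegular : ∀ {n} → Tuple n → Set
  StronglyRegular = Unique

  A : ∀ n → Submodule (Λ n) (c ⊔ ℓ)
  A n = Λ.span n λ t → Allowed t × StronglyRegular t

  Ω : ∀ n → Submodule (Λ n) (c ⊔ ℓ)
  Ω zero    = A zero
  Ω (suc n) = A (suc n) ∩ preimage (∂ n) (A n)

  Cycles : ∀ n → Submodule (Λ n) (c ⊔ ℓ)
  Cycles zero    = Ω zero
  Cycles (suc n) = Ω (suc n) ∩ preimage (∂ n) zeroSubmodule

  -- Since ∂ ∘ ∂ = 0, these lie in Cycles n.

  Boundaries : ∀ n → Submodule (Λ n) (c ⊔ ℓ)
  Boundaries n = image (∂ n) (Ω (suc n))

RegularPathHomology : ∀ {c ℓ} (R : CommutativeRing c ℓ) → Digraph → ℕ → Module R (c ⊔ ℓ) (c ⊔ ℓ)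
RegularPathHomology R G n = Cycles n / Boundaries n
  where open RegularPaths R G

{-# OPTIONS --safe #-}
-- The complete digraph on two vertices is contractible, because every function into a
-- complete digraph is a digraph map. It has the 1-cycle (0,1) + (1,0), but no strongly
-- regular 2-path, so this cycle survives in H₁, whereas H₁ of a point is trivial.

module Submission where

open import Defs
open import Algebra.Bundles using (CommutativeRing)
open import Algebra.Module.Bundles using (Module)
open import Algebra.Module.Morphism.Structures using (IsModuleIsomorphism)
open import Data.Bool.Base using (true)
open import Data.Fin.Base using (Fin; zero; suc)
import Data.Fin.Properties as Fin
open import Data.List.Base using ([]; _∷_)
open import Data.List.Relation.Unary.All using ([]; _∷_)
open import Data.Nat.Base using (ℕ; suc; _≤_; s≤s; z≤n)
open import Data.Product.Base using (_×_; Σ-syntax; _,_)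
open import Data.Vec.Base using (Vec; []; _∷_; lookup)
open import Data.Vec.Relation.Unary.All using ([]; _∷_)
open import Data.Vec.Relation.Unary.AllPairs using ([]; _∷_)
open import Data.Vec.Relation.Unary.Linked using ([-]; _∷_)
open import Data.Vec.Relation.Unary.Unique.Propositional using (Unique)
open import Data.Vec.Relation.Unary.Unique.Propositional.Properties using (lookup-injective)
open import Function.Construct.Identity using (↔-id)
open import Relation.Binary.PropositionalEquality.Core using (_≢_; refl)
import Relation.Binary.Reasoning.Setoid as SetoidReasoning
open import Relation.Nullary using (¬_; ¬?; contradiction)
open import Relation.Nullary.Decidable using (toSum)

complete : ℕ → Digraph
complete n = record
  { Vertex  = Fin n
  ; _≟_     = Fin._≟_
  ; Edge    = _≢_
  ; no-loop = λ x≢x → x≢x refl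
  }

complete-finite : ∀ n → Finite (complete n)
complete-finite n = record
  { size  = n
  ; enum  = ↔-id (Fin n)
  ; edge? = λ x y → ¬? (x Fin.≟ y)
  }

toComplete : ∀ {G n} → (Digraph.Vertex G → Fin n) → DigraphMap G (complete n)
toComplete f = record { fun = f ; fun-edge = λ {x} {y} _ → toSum (f x Fin.≟ f y) }

-- A line with a single edge is enough: put `f` on one end and `g` on the other. No compatibility
-- between them has to be checked, since any function into `complete n` is a digraph map.
toComplete-homotopic : ∀ {G n} (f g : DigraphMap G (complete n)) → Homotopic f g
toComplete-homotopic f g =
  1 , (λ _ → true) , toComplete (λ { (x , zero) → fun f x ; (x , suc zero) → fun g x })
  , (λ _ → refl) , (λ _ → refl)

-- Any maps in the two directions are mutually inverse up to homotopy, so constant ones do; the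
-- successors supply the vertex `zero`.
complete-homotopyEquivalent : ∀ m n → HomotopyEquivalent (complete (suc m)) (complete (suc n))
complete-homotopyEquivalent m n =
    f , g , toComplete-homotopic (g ∘ᴰ f) idᴰ , toComplete-homotopic (f ∘ᴰ g) idᴰ
  where
  f = toComplete λ _ → zero
  g = toComplete λ _ → zero

-- Pigeonhole: the `suc n` entries take at most `m` values, so two of them coincide.
¬unique : ∀ {m n} → m ≤ n → (t : Vec (Fin m) (suc n)) → ¬ Unique t
¬unique m≤n t unique with Fin.pigeonhole (s≤s m≤n) (lookup t)
... | i , j , i<j , eq = Fin.<⇒≢ i<j (lookup-injective unique i j eq)

module _ {c ℓ} {R : CommutativeRing c ℓ} {a ℓa} (M : Module R a ℓa) where

  open CommutativeRing R using (1#; -_; _*_; *-identityʳ)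
  open Module M
  open SetoidReasoning ≈ᴹ-setoid

  -- The unsimplified form in which ∂ 0 evaluates on the edge (u , v).
  endpointDifference : Carrierᴹ → Carrierᴹ → Carrierᴹ
  endpointDifference u v = 1# *ₗ (1# *ₗ v +ᴹ ((- 1# * 1#) *ₗ u +ᴹ 0ᴹ))

  endpointDifference≈ : ∀ u v → endpointDifference u v ≈ᴹ v +ᴹ -ᴹ u
  endpointDifference≈ u v = begin
    1# *ₗ (1# *ₗ v +ᴹ ((- 1# * 1#) *ₗ u +ᴹ 0ᴹ))  ≈⟨ *ₗ-identityˡ _ ⟩
    1# *ₗ v +ᴹ ((- 1# * 1#) *ₗ u +ᴹ 0ᴹ)          ≈⟨ +ᴹ-cong (*ₗ-identityˡ v) (+ᴹ-identityʳ _) ⟩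
    v +ᴹ (- 1# * 1#) *ₗ u                        ≈⟨ +ᴹ-congˡ (*ₗ-congʳ (*-identityʳ (- 1#))) ⟩
    v +ᴹ (- 1#) *ₗ u                             ≈⟨ +ᴹ-congˡ (-1*ₗ M u) ⟩
    v +ᴹ -ᴹ u                                    ∎

  -- The boundaries of an edge and of its reverse cancel. The trailing `0ᴹ` is the end of the
  -- two-term sum produced by `extend`, so the left side is literally `∂ 0` of the round trip.
  endpointDifference-antisym : ∀ u v →
    endpointDifference u v +ᴹ (endpointDifference v u +ᴹ 0ᴹ) ≈ᴹ 0ᴹ
  endpointDifference-antisym u v = begin
    endpointDifference u v +ᴹ (endpointDifference v u +ᴹ 0ᴹ)
      ≈⟨ +ᴹ-cong (endpointDifference≈ u v) (≈ᴹ-trans (+ᴹ-identityʳ _) (endpointDifference≈ v u)) ⟩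
    (v +ᴹ -ᴹ u) +ᴹ (u +ᴹ -ᴹ v)  ≈⟨ +ᴹ-assoc v (-ᴹ u) _ ⟩
    v +ᴹ (-ᴹ u +ᴹ (u +ᴹ -ᴹ v))  ≈⟨ +ᴹ-congˡ (+ᴹ-assoc (-ᴹ u) u _) ⟨
    v +ᴹ ((-ᴹ u +ᴹ u) +ᴹ -ᴹ v)  ≈⟨ +ᴹ-congˡ (+ᴹ-congʳ (-ᴹ‿inverseˡ u)) ⟩
    v +ᴹ (0ᴹ +ᴹ -ᴹ v)           ≈⟨ +ᴹ-congˡ (+ᴹ-identityˡ _) ⟩
    v +ᴹ -ᴹ v                   ≈⟨ -ᴹ‿inverseʳ v ⟩
    0ᴹ                          ∎

module _ {c ℓ} {R : CommutativeRing c ℓ} {a ℓa} {M : Module R a ℓa} {p} (P : Submodule M p) where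

  open CommutativeRing R using (1#; -_)
  open Module M
  open Submodule P

  ≈0⇒mem : ∀ x → x ≈ᴹ 0ᴹ → Member x
  ≈0⇒mem _ x≈0 = resp (≈ᴹ-sym x≈0) 0-mem

  difference-mem : ∀ x y → Member x → Member y → Member (x +ᴹ -ᴹ y)
  difference-mem x y x∈P y∈P = +-mem x∈P (resp (-1*ₗ M y) (*ₗ-mem (- 1#) y∈P))

module _ {c ℓ} (R : CommutativeRing c ℓ) where

  open CommutativeRing R using (_≈_; _+_; 0#; 1#; +-congˡ; +-identityʳ; setoid) renaming (refl to ≈-refl)

  module _ {m : ℕ} where

    open RegularPaths R (complete m)

    -- A nonempty combination would contain a tuple of `suc n` distinct vertices, more than the
    -- digraph has.
    A-trivial : ∀ {n} → m ≤ n → let open Module (Λ n) in ∀ v → Submodule.Member (A n) v → v ≈ᴹ 0ᴹ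
    A-trivial {n} _   v ([] , _ , []≈v)                      = Module.≈ᴹ-sym (Λ n) {[]} {v} []≈v
    A-trivial     m≤n v ((_ , t) ∷ _ , (_ , unique) ∷ _ , _) = contradiction unique (¬unique m≤n t)

    -- A boundary in degree `n` comes from a chain in `A (suc n)`, which already vanishes; hence the
    -- bound `suc n`.
    Boundaries-trivial : ∀ {n} → m ≤ suc n → let open Module (Λ n) in
      ∀ v → Submodule.Member (Boundaries n) v → v ≈ᴹ 0ᴹ
    Boundaries-trivial {n} m≤1+n v (w , (w∈A , _) , ∂w≈v) = begin
      v        ≈⟨ ∂w≈v ⟨
      ∂.to w   ≈⟨ ∂.⟦⟧-cong {w} {[]} (A-trivial m≤1+n w w∈A) ⟩
      ∂.to []  ≈⟨ ∂.0ᴹ-homo ⟩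
      []       ∎
      where
      module ∂ = LinearMap (∂ n)
      open SetoidReasoning (Module.≈ᴹ-setoid (Λ n))

    -- The difference of two cycles lies in `A (suc n)`, hence is zero, and zero is a boundary.
    homology-trivial : ∀ {n} → m ≤ suc n →
      let open Module (RegularPathHomology R (complete m) (suc n)) in ∀ x y → x ≈ᴹ y
    homology-trivial {n} m≤1+n (x , (x∈A , _) , _) (y , (y∈A , _) , _) =
      ≈0⇒mem (Boundaries (suc n)) x-y (A-trivial m≤1+n x-y (difference-mem (A (suc n)) x y x∈A y∈A))
      where
      open Module (Λ (suc n))
      x-y = x +ᴹ -ᴹ y

  open RegularPaths R (complete 2)

  roundTrip : Module.Carrierᴹ (Λ 1)
  roundTrip = Λ.basis 1 (zero ∷ suc zero ∷ []) +ᴹ Λ.basis 1 (suc zero ∷ zero ∷ [])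
    where open Module (Λ 1)

  roundTrip∈A : Submodule.Member (A 1) roundTrip
  roundTrip∈A = roundTrip
              , ((λ ()) ∷ [-] , ((λ ()) ∷ []) ∷ [] ∷ []) ∷ ((λ ()) ∷ [-] , ((λ ()) ∷ []) ∷ [] ∷ []) ∷ []
              , λ _ → ≈-refl

  ∂roundTrip≈0 : let open Module (Λ 0) in LinearMap.to (∂ 0) roundTrip ≈ᴹ 0ᴹ
  ∂roundTrip≈0 = endpointDifference-antisym (Λ 0) (Λ.basis 0 (zero ∷ [])) (Λ.basis 0 (suc zero ∷ []))

  roundTrip∈Cycles : Submodule.Member (Cycles 1) roundTrip
  roundTrip∈Cycles =
    -- The boundary lies in `A 0`, as `Ω 1` demands, simply because it is zero.
    (roundTrip∈A , ≈0⇒mem (A 0) (LinearMap.to (∂ 0) roundTrip) ∂roundTrip≈0) , ∂roundTrip≈0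

  roundTrip-nontrivial : ¬ (1# ≈ 0#) →
    let open Module (RegularPathHomology R (complete 2) 1) in ¬ ((roundTrip , roundTrip∈Cycles) ≈ᴹ 0ᴹ)
  roundTrip-nontrivial 1≉0 roundTrip∼0 = 1≉0 (begin
    -- `1# + (0# + 0#)` is the coefficient of `roundTrip` at the edge from `zero` to `suc zero`, as
    -- `coeff` evaluates it. It vanishes because all boundaries in degree 1 do.
    1#                 ≈⟨ +-identityʳ 1# ⟨
    1# + 0#            ≈⟨ +-congˡ (+-identityʳ 0#) ⟨
    1# + (0# + 0#)     ≈⟨ Boundaries-trivial (s≤s (s≤s z≤n)) roundTrip roundTrip∼0 (zero ∷ suc zero ∷ []) ⟩
    0#                 ∎)
    where open SetoidReasoning setoid

corollary5p20 : ∀ {c ℓ} (R : CommutativeRing c ℓ) →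
    let open CommutativeRing R in ¬ (1# ≈ 0#) →
    Σ[ G ∈ Digraph ] Σ[ H ∈ Digraph ]
    Finite G × Finite H × HomotopyEquivalent G H ×
    (Σ[ n ∈ ℕ ] ¬ (RegularPathHomology R G n ≅ RegularPathHomology R H n))
corollary5p20 R 1≉0 =
    complete 2 , complete 1 , complete-finite 2 , complete-finite 1
  , complete-homotopyEquivalent 1 0
  -- In degree 1 the homology of the point identifies `f z` with `f 0ᴹ`, so injectivity would make
  -- the class of the round trip zero.
  , 1 , λ (f , f-iso) → roundTrip-nontrivial R 1≉0
      (IsModuleIsomorphism.injective f-iso {z} {0ᴹ} (homology-trivial R (s≤s z≤n) (f z) (f 0ᴹ)))
  where
  open Module (RegularPathHomology R (complete 2) 1)
  z = roundTrip R , roundTrip∈Cycles R
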